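{- Let $T$ be a propositional theory over $\mathcal V$, let $(\mathcal A,\oplus,\otimes,e^\oplus,e^\otimes)$ be a commutative semiring, and let $\alpha:\mathcal L\to\mathcal A$ be a labeling function on the literals of $\mathcal V$ such that $(\oplus,\alpha)$ is neutral, i.e. $\alpha(v)\oplus\alpha(\neg v)=e^\otimes$ for all $v\in\mathcal V$. If $N_T$ is a d-DNNF representation of $T$ (i.e. an NNF circuit over $\mathcal V$ that is deterministic and decomposable and is logically equivalent to $T$), then evaluating $N_T$ is a sound AMC computation, i.e. $$\mathrm{Eval}(N_T,\oplus,\otimes,e^\oplus,e^\otimes,\alpha)=\mathbf A(T).$$
   Context: A semiring $(\mathcal A,\oplus,\otimes,e^\oplus,e^\otimes)$ has associative binary operations $\oplus,\otimes$ on $\mathcal A$, with $\oplus$ commutative, $\otimes$ distributing over $\oplus$, $e^\oplus$ neutral for $\oplus$, $e^\otimes$ neutral for $\otimes$, and $e^\oplus\otimes a=a\otimes e^\oplus=e^\oplus$ for all $a$. It is commutative if $\otimes$ is also commutative. Algebraic model count: for a propositional theory $T$ over a finite set $\mathcal V$ of variables and $\alpha:\mathcal L\to\mathcal A$ on the set $\mathcal L$ of literals of $\mathcal V$, $$\mathbf A(T)=\bigoplus_{I\in\mathcal M(T)}\ \bigotimes_{l\in I}\alpha(l),$$ where $\mathcal M(T)$ is the set of models of $T$; a model is a set of literals containing exactly one of $v,\neg v$ for each $v\in\mathcal V$. Empty sums are $e^\oplus$, empty products $e^\otimes$. An NNF circuit over $\mathcal V$ is a finite rooted directed acyclic graph whose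 leaves are labeled with $\top$, $\bot$ or a literal of a variable in $\mathcal V$, and whose internal nodes are labeled $\vee$ or $\wedge$. Each node is identified with the formula of the subcircuit rooted at it, and its variables are those occurring in that subcircuit. The circuit is decomposable if for each conjunction node $\bigwedge_{i=1}^n\phi_i$ no two children $\phi_i,\phi_j$ ($i\ne j$) share a variable; deterministic if for each disjunction node $\bigvee_{i=1}^n\phi_i$ each two children $\phi_i,\phi_j$ ($i\ne j$) are logically inconsistent. $\mathrm{Eval}$ is defined recursively from the leaves to the root: $\top\mapsto e^\otimes$, $\bot\mapsto e^\oplus$, literal $l\mapsto\alpha(l)$, a disjunction node $\mapsto$ the $\oplus$-sum of the values of its children, a conjunction node $\mapsto$ the $\otimes$-product of the values of its children; the value of the circuit is that of its root. -}

module Defs where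

open import Level using (Level)
open import Algebra.Bundles using (CommutativeSemiring)
open import Data.Bool.Base as Bool using (Bool; true; false; if_then_else_)
import Data.Bool.Properties as Bool
open import Data.Fin.Base using (Fin)
open import Data.Fin.Induction using (spo-wellFounded)
open import Data.List.Base using (List; []; _∷_; map; foldr; filter; tabulate; cartesianProductWith)
open import Data.List.NonEmpty.Base using (List⁺; toList)
open import Data.List.Membership.Propositional using (_∈_; mapWith∈)
open import Data.List.Relation.Unary.All using (All; all?)
open import Data.List.Relation.Unary.AllPairs using (AllPairs)
open import Data.Nat.Base using (ℕ; zero; suc)
open import Data.Product.Base using (_×_; _,_; ∃-syntax)
open import Data.Vec.Base using (Vec; []; _∷_; lookup)
open import Function.Base using (_∘_)
open import Function.Bundles using (_⇔_)
open import Induction.WellFounded using (Acc; acc; WellFounded)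
open import Relation.Binary.Construct.Closure.ReflexiveTransitive using (Star)
open import Relation.Binary.Construct.Closure.Transitive using (TransClosure; transitive; wellFounded⁻)
open import Relation.Binary.Core using (Rel)
open import Relation.Binary.PropositionalEquality using (_≡_; refl; isEquivalence; resp₂)
open import Relation.Nullary.Decidable.Core using (Dec)
open import Relation.Nullary.Negation.Core using (¬_)

-- The set of variables is Fin n.
data Literal (n : ℕ) : Set where
  pos neg : Fin n → Literal n

var : ∀ {n} → Literal n → Fin n
var (pos v) = v
var (neg v) = v

infix  9 ¬ᶠ_
infixr 8 _∧ᶠ_
infixr 7 _∨ᶠ_
infixr 6 _⇒ᶠ_
infix  5 _⇔ᶠ_

data Formula (n : ℕ) : Set where
  ⊤ᶠ ⊥ᶠ                    : Formula n
  varᶠ                     : Fin n → Formula n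
  ¬ᶠ_                      : Formula n → Formula n
  _∧ᶠ_ _∨ᶠ_ _⇒ᶠ_ _⇔ᶠ_      : Formula n → Formula n → Formula n

⋀ᶠ ⋁ᶠ : ∀ {n} → List (Formula n) → Formula n
⋀ᶠ = foldr _∧ᶠ_ ⊤ᶠ
⋁ᶠ = foldr _∨ᶠ_ ⊥ᶠ

literalᶠ : ∀ {n} → Literal n → Formula n
literalᶠ (pos v) = varᶠ v
literalᶠ (neg v) = ¬ᶠ varᶠ v

Theory : ℕ → Set
Theory n = List (Formula n)

-- A set of literals containing exactly one of pos v, neg v for each v is
-- given by the choice made at each v: true for pos v, false for neg v.
Interpretation : ℕ → Set
Interpretation n = Vec Bool n

literals : ∀ {n} → Interpretation n → List (Literal n)
literals I = tabulate λ v → if lookup I v then pos v else neg v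

⟦_⟧ : ∀ {n} → Formula n → Interpretation n → Bool
⟦ ⊤ᶠ     ⟧ I = true
⟦ ⊥ᶠ     ⟧ I = false
⟦ varᶠ v ⟧ I = lookup I v
⟦ ¬ᶠ φ   ⟧ I = Bool.not (⟦ φ ⟧ I)
⟦ φ ∧ᶠ ψ ⟧ I = ⟦ φ ⟧ I Bool.∧ ⟦ ψ ⟧ I
⟦ φ ∨ᶠ ψ ⟧ I = ⟦ φ ⟧ I Bool.∨ ⟦ ψ ⟧ I
⟦ φ ⇒ᶠ ψ ⟧ I = Bool.not (⟦ φ ⟧ I) Bool.∨ ⟦ ψ ⟧ I
⟦ φ ⇔ᶠ ψ ⟧ I = Bool.not (⟦ φ ⟧ I Bool.xor ⟦ ψ ⟧ I)

infix 4 _⊨_ _⊨ᵀ_ _⊨ᵀ?_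

_⊨_ : ∀ {n} → Interpretation n → Formula n → Set
I ⊨ φ = ⟦ φ ⟧ I ≡ true

_⊨ᵀ_ : ∀ {n} → Interpretation n → Theory n → Set
I ⊨ᵀ T = All (I ⊨_) T

_⊨ᵀ?_ : ∀ {n} (I : Interpretation n) (T : Theory n) → Dec (I ⊨ᵀ T)
I ⊨ᵀ? T = all? (λ φ → ⟦ φ ⟧ I Bool.≟ true) T

Inconsistent : ∀ {n} → Formula n → Formula n → Set
Inconsistent φ ψ = ∀ I → ¬ (I ⊨ φ × I ⊨ ψ)

-- Every interpretation occurs exactly once.
interpretations : ∀ n → List (Interpretation n)
interpretations zero    = [] ∷ []
interpretations (suc n) =
  cartesianProductWith _∷_ (true ∷ false ∷ []) (interpretations n)

models : ∀ {n} → Theory n → List (Interpretation n)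
models {n} T = filter (_⊨ᵀ? T) (interpretations n)

data Leaf (n : ℕ) : Set where
  top bot : Leaf n
  lit     : Literal n → Leaf n

-- Internal nodes have at least one child. The order of the children is
-- immaterial, and a child may be listed twice (a parallel edge).
data Node (n m : ℕ) : Set where
  leaf      : Leaf n → Node n m
  conj disj : List⁺ (Fin m) → Node n m

children : ∀ {n m} → Node n m → List (Fin m)
children (leaf _)  = []
children (conj ks) = toList ks
children (disj ks) = toList ks

record Circuit (n : ℕ) : Set where
  field
    size : ℕ
    node : Fin size → Node n size
    root : Fin size

  infix 4 _childOf_
  _childOf_ : Rel (Fin size) _
  j childOf k = j ∈ children (node k)

  field
    acyclic : ∀ k → ¬ TransClosure _childOf_ k k
    rooted  : ∀ k → Star _childOf_ k root

  childOf-wellFounded : WellFounded _childOf_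
  childOf-wellFounded = wellFounded⁻ _childOf_ (spo-wellFounded record
    { isEquivalence = isEquivalence
    ; irrefl        = λ { {k} refl → acyclic k }
    ; trans         = transitive _childOf_
    ; <-resp-≈      = resp₂ _
    })

module Fold {a} {A : Set a} {n : ℕ}
            (onLeaf : Leaf n → A) (onConj onDisj : List A → A)
            (N : Circuit n) where
  open Circuit N

  step : ∀ {m} (x : Node n m) → (∀ {j} → j ∈ children x → A) → A
  step (leaf l)  rec = onLeaf l
  step (conj ks) rec = onConj (mapWith∈ (toList ks) rec)
  step (disj ks) rec = onDisj (mapWith∈ (toList ks) rec)

  foldAcc : ∀ k → Acc _childOf_ k → A
  foldAcc k (acc rs) = step (node k) λ {j} j∈ → foldAcc j (rs j∈)

  fold : Fin size → A
  fold k = foldAcc k (childOf-wellFounded k)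

leafᶠ : ∀ {n} → Leaf n → Formula n
leafᶠ top     = ⊤ᶠ
leafᶠ bot     = ⊥ᶠ
leafᶠ (lit l) = literalᶠ l

module _ {n : ℕ} (N : Circuit n) where
  open Circuit N

  formula : Fin size → Formula n
  formula = Fold.fold leafᶠ ⋀ᶠ ⋁ᶠ N

  Occurs : Fin n → Fin size → Set
  Occurs v k = ∃[ j ] ∃[ l ] Star _childOf_ j k × node j ≡ leaf (lit l) × var l ≡ v

  -- Both pairwise relations are symmetric, so that AllPairs, which compares
  -- each child only with the later ones, covers every pair of positions.
  Decomposable : Set
  Decomposable = ∀ k ks → node k ≡ conj ks →
    AllPairs (λ i j → ∀ v → ¬ (Occurs v i × Occurs v j)) (toList ks)

  Deterministic : Set
  Deterministic = ∀ k ks → node k ≡ disj ks →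
    AllPairs (λ i j → Inconsistent (formula i) (formula j)) (toList ks)

record IsDDNNF {n : ℕ} (N : Circuit n) (T : Theory n) : Set where
  field
    decomposable  : Decomposable N
    deterministic : Deterministic N
    equivalent    : ∀ I → I ⊨ formula N (Circuit.root N) ⇔ I ⊨ᵀ T

module _ {c ℓ : Level} (R : CommutativeSemiring c ℓ) where
  open CommutativeSemiring R

  ⨁ ⨂ : List Carrier → Carrier
  ⨁ = foldr _+_ 0#
  ⨂ = foldr _*_ 1#

  module _ {n : ℕ} (α : Literal n → Carrier) where

    Neutral : Set ℓ
    Neutral = ∀ v → α (pos v) + α (neg v) ≈ 1#

    AMC : Theory n → Carrier
    AMC T = ⨁ (map (⨂ ∘ map α ∘ literals) (models T))

    evalLeaf : Leaf n → Carrier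
    evalLeaf top     = 1#
    evalLeaf bot     = 0#
    evalLeaf (lit l) = α l

    Eval : Circuit n → Carrier
    Eval N = Fold.fold evalLeaf ⨂ ⨁ N (Circuit.root N)

{-# OPTIONS --safe #-}
module Submission where

-- Fix weights w v b for the value b of the variable v, with
-- w v true + w v false ≈ 1#. The weighted count of a Boolean function f on
-- interpretations is the sum, over the interpretations I with f I ≡ true, of
-- the product of the weights of the values in I. Normalised weights make it
-- behave like a probability:
--
--   * true has count 1#, false has count 0#, a literal counts for its weight
--     (count-true, count-false, count-lookup);
--   * the count of a disjunction of exclusive functions is the sum of the
--     counts (count-∨);
--   * the count of a conjunction of independent functions, that is, such that
--     every variable is irrelevant to one of them, is the product of the
--     counts (count-∧).
--
-- Normalisation enters through summing out a variable that is irrelevant to a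
-- function: it leaves the count unchanged, so variables absent from a
-- subcircuit do not affect its value.
--
-- Determinism makes the children of a disjunction node exclusive, and
-- decomposability makes those of a conjunction node independent, since a
-- variable that does not occur below a node is irrelevant to its formula
-- (occurs⊎irrelevant). By well-founded induction along the circuit, the value
-- of every node is the count of its formula (value≈count). At the root the
-- formula is equivalent to the theory, whose count is its algebraic model
-- count (AMC≈count).

open import Defs
open import Level using (Level)
open import Algebra.Bundles using (CommutativeSemiring)
open import Data.Nat.Base using (ℕ; zero; suc)

import Algebra.Properties.CommutativeSemigroup as CommutativeSemigroupProperties
open import Data.Bool.Base using (Bool; true; false; not; _∧_; _∨_; if_then_else_)
open import Data.Bool.Properties using (∧-comm; ⇔→≡)
open import Data.Fin.Base using (Fin; zero; suc)
open import Data.Fin.Properties using (_≟_)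
open import Data.List.Base
  using (List; []; _∷_; _++_; map; filter; tabulate; foldr)
open import Data.List.Membership.Propositional using (_∈_; find)
open import Data.List.Membership.Propositional.Properties
  using (mapWith∈-cong; mapWith∈≗map)
open import Data.List.NonEmpty.Base using (toList)
open import Data.List.Properties
  using (map-++; map-∘; map-tabulate; ++-identityʳ; filter-accept; filter-reject)
open import Data.List.Relation.Unary.Any using (Any; here; there; satisfied)
open import Data.List.Relation.Unary.All as All using (All; []; _∷_)
import Data.List.Relation.Unary.All.Properties as All
open import Data.List.Relation.Unary.AllPairs as AllPairs using (AllPairs; []; _∷_)
import Data.List.Relation.Unary.AllPairs.Properties as AllPairs
open import Data.Product.Base using (_×_; _,_)
open import Data.Sum.Base using (_⊎_; inj₁; inj₂; map₂)
open import Data.Vec.Base using ([]; _∷_; lookup; _[_]≔_)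
open import Data.Vec.Properties using (lookup∘update′)
open import Function.Base using (_∘_; const)
open import Function.Bundles using (_⇔_; mk⇔; Equivalence)
open import Function.Construct.Composition using (_⇔-∘_)
open import Induction.WellFounded as WF using (Acc; acc)
open import Relation.Binary.Construct.Closure.ReflexiveTransitive using (ε; _◅◅_; _◅_)
open import Relation.Binary.PropositionalEquality as ≡
  using (_≡_; refl; cong; cong₂; subst)
import Relation.Binary.Reasoning.Setoid as SetoidReasoning
open import Relation.Nullary.Decidable.Core using (yes; no)
open import Relation.Nullary.Negation using (¬_; contradiction)

-- Boolean functions of an interpretation

-- A set of interpretations, given by its characteristic function.
Predicate : ℕ → Set
Predicate n = Interpretation n → Bool

-- The value of f does not depend on the variable v.
Irrelevant : ∀ {n} → Fin n → Predicate n → Set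
Irrelevant v f = ∀ b I → f (I [ v ]≔ b) ≡ f I

-- No variable is relevant to both functions; stated positively, so that a proof
-- tells for each variable which of the two ignores it.
Independent : ∀ {n} → Predicate n → Predicate n → Set
Independent f g = ∀ v → Irrelevant v f ⊎ Irrelevant v g

-- No interpretation satisfies both functions.
Exclusive : ∀ {n} → Predicate n → Predicate n → Set
Exclusive f g = ∀ I → ¬ (f I ≡ true × g I ≡ true)

any⊎all : ∀ {a p q} {A : Set a} {P : A → Set p} {Q : A → Set q} {xs} →
          All (λ x → P x ⊎ Q x) xs → Any P xs ⊎ All Q xs
any⊎all []            = inj₂ []
any⊎all (inj₁ p ∷ _)  = inj₁ (here p)
any⊎all (inj₂ q ∷ rs) with any⊎all rs
... | inj₁ some = inj₁ (there some)
... | inj₂ all  = inj₂ (q ∷ all)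

irrelevant-section : ∀ {n v} {f : Predicate (suc n)} b →
                     Irrelevant (suc v) f → Irrelevant v (f ∘ (b ∷_))
irrelevant-section b irr c I = irr c (b ∷ I)

independent-section : ∀ {n} {f g : Predicate (suc n)} b →
                      Independent f g → Independent (f ∘ (b ∷_)) (g ∘ (b ∷_))
independent-section {f = f} {g} b ind v with ind (suc v)
... | inj₁ irr = inj₁ (irrelevant-section {f = f} b irr)
... | inj₂ irr = inj₂ (irrelevant-section {f = g} b irr)

irrelevant-⋀ : ∀ {n v} {φs : List (Formula n)} →
               All (Irrelevant v ∘ ⟦_⟧) φs → Irrelevant v ⟦ ⋀ᶠ φs ⟧
irrelevant-⋀ []           b I = refl
irrelevant-⋀ (irr ∷ irrs) b I = cong₂ _∧_ (irr b I) (irrelevant-⋀ irrs b I)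

irrelevant-⋁ : ∀ {n v} {φs : List (Formula n)} →
               All (Irrelevant v ∘ ⟦_⟧) φs → Irrelevant v ⟦ ⋁ᶠ φs ⟧
irrelevant-⋁ []           b I = refl
irrelevant-⋁ (irr ∷ irrs) b I = cong₂ _∨_ (irr b I) (irrelevant-⋁ irrs b I)

independent-⋀ : ∀ {n} {f : Predicate n} {φs : List (Formula n)} →
                All (λ φ → Independent f ⟦ φ ⟧) φs → Independent f ⟦ ⋀ᶠ φs ⟧
independent-⋀ inds v with any⊎all (All.map (λ ind → ind v) inds)
... | inj₁ some with _ , irr ← satisfied some = inj₁ irr
... | inj₂ irrs = inj₂ (irrelevant-⋀ irrs)

irrelevant-literal : ∀ {n v} (l : Literal n) → ¬ var l ≡ v →
                     Irrelevant v ⟦ literalᶠ l ⟧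
irrelevant-literal {v = v} (pos u) u≢v b I = lookup∘update′ u≢v I b
irrelevant-literal {v = v} (neg u) u≢v b I =
  cong not (lookup∘update′ u≢v I b)

exclusive-⋁ : ∀ {n} {f : Predicate n} {φs : List (Formula n)} →
              All (λ φ → Exclusive f ⟦ φ ⟧) φs → Exclusive f ⟦ ⋁ᶠ φs ⟧
exclusive-⋁ []                          I (_ , ())
exclusive-⋁ {φs = φ ∷ _} (excl ∷ excls) I (p , q) with ⟦ φ ⟧ I in eq
... | true  = excl I (p , eq)
... | false = exclusive-⋁ excls I (p , q)

-- A theory is equivalent to the conjunction of its formulas, so that its models
-- too can be counted as those of a Boolean function.
⊨ᵀ⇔⊨⋀ : ∀ {n} (I : Interpretation n) T → I ⊨ᵀ T ⇔ I ⊨ ⋀ᶠ T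
⊨ᵀ⇔⊨⋀ I T = mk⇔ to (from T)
  where
  to : ∀ {T} → I ⊨ᵀ T → I ⊨ ⋀ᶠ T
  to []       = refl
  to (p ∷ ps) = cong₂ _∧_ p (to ps)

  from : ∀ T → I ⊨ ⋀ᶠ T → I ⊨ᵀ T
  from []      _ = []
  from (φ ∷ T) p with ⟦ φ ⟧ I in eq
  from (φ ∷ T) p | true  = eq ∷ from T p
  from (φ ∷ T) () | false

-- Weighted counting in a commutative semiring

module Counting {c ℓ} (R : CommutativeSemiring c ℓ) where
  open CommutativeSemiring R hiding (refl; zero)
  open CommutativeSemiring R using () renaming (refl to ≈-refl)
  open CommutativeSemigroupProperties *-commutativeSemigroup using (x∙yz≈y∙xz)
  open CommutativeSemigroupProperties +-commutativeSemigroup using (interchange)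
  open SetoidReasoning setoid

  -- The weights of the two values of each variable.
  Weighting : ℕ → Set c
  Weighting n = Fin n → Bool → Carrier

  Normalised : ∀ {n} → Weighting n → Set ℓ
  Normalised w = ∀ v → w v true + w v false ≈ 1#

  -- The labels of literals as weights; Normalised for it is Neutral for α.
  labelWeighting : ∀ {n} → (Literal n → Carrier) → Weighting n
  labelWeighting α v b = α (if b then pos v else neg v)

  -- The Iverson bracket.
  indicator : Bool → Carrier
  indicator b = if b then 1# else 0#

  -- The sum over the interpretations satisfying f, organised by branching on
  -- the variables in order.
  count : ∀ {n} → Weighting n → Predicate n → Carrier
  count {zero}  w f = indicator (f [])
  count {suc n} w f = w zero true  * count (w ∘ suc) (f ∘ (true  ∷_))
                    + w zero false * count (w ∘ suc) (f ∘ (false ∷_))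

  count-cong : ∀ {n} (w : Weighting n) {f g} → (∀ I → f I ≡ g I) →
               count w f ≈ count w g
  count-cong {zero}  w f≗g = reflexive (cong indicator (f≗g []))
  count-cong {suc n} w f≗g =
    +-cong (*-congˡ (count-cong (w ∘ suc) λ I → f≗g (true ∷ I)))
           (*-congˡ (count-cong (w ∘ suc) λ I → f≗g (false ∷ I)))

  count-false : ∀ {n} (w : Weighting n) → count w (const false) ≈ 0#
  count-false {zero}  w = ≈-refl
  count-false {suc n} w = begin
    w zero true * F + w zero false * F ≈⟨ distribʳ _ _ _ ⟨
    (w zero true + w zero false) * F   ≈⟨ *-congˡ (count-false (w ∘ suc)) ⟩
    (w zero true + w zero false) * 0#  ≈⟨ zeroʳ _ ⟩
    0#                                 ∎
    where F = count (w ∘ suc) (const false)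

  indicator-∨ : ∀ a b → ¬ (a ≡ true × b ≡ true) →
                indicator (a ∨ b) ≈ indicator a + indicator b
  indicator-∨ true  true  ¬ab = contradiction (refl , refl) ¬ab
  indicator-∨ true  false ¬ab = sym (+-identityʳ 1#)
  indicator-∨ false b     ¬ab = sym (+-identityˡ (indicator b))

  indicator-∧ : ∀ a b → indicator (a ∧ b) ≈ indicator a * indicator b
  indicator-∧ true  b = sym (*-identityˡ (indicator b))
  indicator-∧ false b = sym (zeroˡ (indicator b))

  count-∨ : ∀ {n} (w : Weighting n) f g → Exclusive f g →
            count w (λ I → f I ∨ g I) ≈ count w f + count w g
  count-∨ {zero}  w f g excl = indicator-∨ (f []) (g []) (excl [])
  count-∨ {suc n} w f g excl = begin
    a * count w′ (λ I → f (true ∷ I) ∨ g (true ∷ I))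
      + b * count w′ (λ I → f (false ∷ I) ∨ g (false ∷ I))
      ≈⟨ +-cong (*-congˡ (count-∨ w′ _ _ λ I → excl (true ∷ I)))
                (*-congˡ (count-∨ w′ _ _ λ I → excl (false ∷ I))) ⟩
    a * (F true + G true) + b * (F false + G false)
      ≈⟨ +-cong (distribˡ _ _ _) (distribˡ _ _ _) ⟩
    (a * F true + a * G true) + (b * F false + b * G false)
      ≈⟨ interchange _ _ _ _ ⟩
    (a * F true + b * F false) + (a * G true + b * G false)
      ∎
    where
    a  = w zero true
    b  = w zero false
    w′ = w ∘ suc
    F G : Bool → Carrier
    F x = count w′ (f ∘ (x ∷_))
    G x = count w′ (g ∘ (x ∷_))

  module _ {n} (w : Weighting (suc n)) (norm : Normalised w) where

    -- The weighted average of x with itself.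
    average : ∀ x → w zero true * x + w zero false * x ≈ x
    average x = begin
      w zero true * x + w zero false * x ≈⟨ distribʳ _ _ _ ⟨
      (w zero true + w zero false) * x   ≈⟨ *-congʳ (norm zero) ⟩
      1# * x                             ≈⟨ *-identityˡ x ⟩
      x                                  ∎

    -- Summing out an irrelevant variable: fixing its value keeps the count.
    count-section : ∀ {f} → Irrelevant zero f → ∀ b →
                    count (w ∘ suc) (f ∘ (b ∷_)) ≈ count w f
    count-section {f} irr b = begin
      F b                                            ≈⟨ average (F b) ⟨
      w zero true * F b + w zero false * F b         ≈⟨ +-cong (*-congˡ (F-const true))
                                                               (*-congˡ (F-const false)) ⟩
      w zero true * F true + w zero false * F false  ∎
      where
      F : Bool → Carrier
      F x = count (w ∘ suc) (f ∘ (x ∷_))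
      F-const : ∀ c → F b ≈ F c
      F-const c = count-cong (w ∘ suc) λ I → irr b (c ∷ I)

    -- One step of the induction for count-∧, when the variable being branched
    -- on is irrelevant to f: both branches have the same factor count w f.
    count-∧-step : ∀ f g → Irrelevant zero f →
      (∀ b → count (w ∘ suc) (λ I → f (b ∷ I) ∧ g (b ∷ I))
             ≈ count (w ∘ suc) (f ∘ (b ∷_)) * count (w ∘ suc) (g ∘ (b ∷_))) →
      count w (λ I → f I ∧ g I) ≈ count w f * count w g
    count-∧-step f g irr ih =
      trans (+-cong (branch true) (branch false)) (sym (distribˡ _ _ _))
      where
      branch : ∀ b →
        w zero b * count (w ∘ suc) (λ I → f (b ∷ I) ∧ g (b ∷ I))
          ≈ count w f * (w zero b * count (w ∘ suc) (g ∘ (b ∷_)))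
      branch b = begin
        w zero b * count (w ∘ suc) (λ I → f (b ∷ I) ∧ g (b ∷ I))
          ≈⟨ *-congˡ (ih b) ⟩
        w zero b * (count (w ∘ suc) (f ∘ (b ∷_)) * count (w ∘ suc) (g ∘ (b ∷_)))
          ≈⟨ *-congˡ (*-congʳ (count-section irr b)) ⟩
        w zero b * (count w f * count (w ∘ suc) (g ∘ (b ∷_)))
          ≈⟨ x∙yz≈y∙xz _ _ _ ⟩
        count w f * (w zero b * count (w ∘ suc) (g ∘ (b ∷_)))
          ∎

  count-true : ∀ {n} (w : Weighting n) → Normalised w → count w (const true) ≈ 1#
  count-true {zero}  w norm = ≈-refl
  count-true {suc n} w norm =
    trans (average w norm _) (count-true (w ∘ suc) (norm ∘ suc))

  count-∧ : ∀ {n} (w : Weighting n) → Normalised w → ∀ f g → Independent f g →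
            count w (λ I → f I ∧ g I) ≈ count w f * count w g
  count-∧ {zero}  w norm f g ind = indicator-∧ (f []) (g [])
  count-∧ {suc n} w norm f g ind with ind zero
  ... | inj₁ irr = count-∧-step w norm f g irr λ b →
    count-∧ (w ∘ suc) (norm ∘ suc) _ _ (independent-section b ind)
  ... | inj₂ irr = begin
    count w (λ I → f I ∧ g I) ≈⟨ count-cong w (λ I → ∧-comm (f I) (g I)) ⟩
    count w (λ I → g I ∧ f I) ≈⟨ count-∧-step w norm g f irr swapped ⟩
    count w g * count w f     ≈⟨ *-comm _ _ ⟩
    count w f * count w g     ∎
    where
    swapped : ∀ b → count (w ∘ suc) (λ I → g (b ∷ I) ∧ f (b ∷ I))
                    ≈ count (w ∘ suc) (g ∘ (b ∷_)) * count (w ∘ suc) (f ∘ (b ∷_))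
    swapped b = begin
      count (w ∘ suc) (λ I → g (b ∷ I) ∧ f (b ∷ I))
        ≈⟨ count-cong (w ∘ suc) (λ I → ∧-comm (g (b ∷ I)) (f (b ∷ I))) ⟩
      count (w ∘ suc) (λ I → f (b ∷ I) ∧ g (b ∷ I))
        ≈⟨ count-∧ (w ∘ suc) (norm ∘ suc) _ _ (independent-section b ind) ⟩
      count (w ∘ suc) (f ∘ (b ∷_)) * count (w ∘ suc) (g ∘ (b ∷_))
        ≈⟨ *-comm _ _ ⟩
      count (w ∘ suc) (g ∘ (b ∷_)) * count (w ∘ suc) (f ∘ (b ∷_))
        ∎

  count-const : ∀ {n} (w : Weighting n) → Normalised w → ∀ b →
                count w (const b) ≈ indicator b
  count-const w norm true  = count-true w norm
  count-const w norm false = count-false w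

  count-⋁ : ∀ {n} (w : Weighting n) {φs : List (Formula n)} →
            AllPairs (λ φ ψ → Exclusive ⟦ φ ⟧ ⟦ ψ ⟧) φs →
            count w ⟦ ⋁ᶠ φs ⟧ ≈ ⨁ R (map (count w ∘ ⟦_⟧) φs)
  count-⋁ w []                      = count-false w
  count-⋁ w {φ ∷ φs} (excl ∷ excls) =
    trans (count-∨ w ⟦ φ ⟧ ⟦ ⋁ᶠ φs ⟧ (exclusive-⋁ excl)) (+-congˡ (count-⋁ w excls))

  count-⋀ : ∀ {n} (w : Weighting n) → Normalised w → {φs : List (Formula n)} →
            AllPairs (λ φ ψ → Independent ⟦ φ ⟧ ⟦ ψ ⟧) φs →
            count w ⟦ ⋀ᶠ φs ⟧ ≈ ⨂ R (map (count w ∘ ⟦_⟧) φs)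
  count-⋀ w norm []                    = count-true w norm
  count-⋀ w norm {φ ∷ φs} (ind ∷ inds) =
    trans (count-∧ w norm ⟦ φ ⟧ ⟦ ⋀ᶠ φs ⟧ (independent-⋀ ind))
          (*-congˡ (count-⋀ w norm inds))

  -- If only the variable v matters, all others are summed out. The literals on v
  -- are the cases where h is the identity or negation.
  count-lookup : ∀ {n} (w : Weighting n) → Normalised w → ∀ v (h : Bool → Bool) →
                 count w (λ I → h (lookup I v))
                 ≈ w v true * indicator (h true) + w v false * indicator (h false)
  count-lookup w norm zero    h =
    +-cong (*-congˡ (count-const (w ∘ suc) (norm ∘ suc) (h true)))
           (*-congˡ (count-const (w ∘ suc) (norm ∘ suc) (h false)))
  count-lookup w norm (suc v) h =
    trans (average w norm _) (count-lookup (w ∘ suc) (norm ∘ suc) v h)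

  evalLeaf≈count : ∀ {n} (α : Literal n → Carrier) → Neutral R α → ∀ l →
                   evalLeaf R α l ≈ count (labelWeighting α) ⟦ leafᶠ l ⟧
  evalLeaf≈count α neutral top           = sym (count-true _ neutral)
  evalLeaf≈count α neutral bot           = sym (count-false (labelWeighting α))
  evalLeaf≈count α neutral (lit (pos v)) = sym (begin
    count (labelWeighting α) (λ I → lookup I v) ≈⟨ count-lookup _ neutral v (λ b → b) ⟩
    α (pos v) * 1# + α (neg v) * 0#             ≈⟨ +-cong (*-identityʳ _) (zeroʳ _) ⟩
    α (pos v) + 0#                              ≈⟨ +-identityʳ _ ⟩
    α (pos v)                                   ∎)
  evalLeaf≈count α neutral (lit (neg v)) = sym (begin
    count (labelWeighting α) (λ I → not (lookup I v)) ≈⟨ count-lookup _ neutral v not ⟩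
    α (pos v) * 0# + α (neg v) * 1#                   ≈⟨ +-cong (zeroʳ _) (*-identityʳ _) ⟩
    0# + α (neg v)                                    ≈⟨ +-identityˡ _ ⟩
    α (neg v)                                         ∎)

-- The algebraic model count as a count

  -- The product of the weights of the values in an interpretation.
  weight : ∀ {n} → Weighting n → Interpretation n → Carrier
  weight w I = ⨂ R (tabulate λ v → w v (lookup I v))

  ⨁-++ : ∀ xs ys → ⨁ R (xs ++ ys) ≈ ⨁ R xs + ⨁ R ys
  ⨁-++ []       ys = sym (+-identityˡ _)
  ⨁-++ (x ∷ xs) ys = trans (+-congˡ (⨁-++ xs ys)) (sym (+-assoc _ _ _))

  ⨁-map-cong : ∀ {a} {A : Set a} {f g : A → Carrier} → (∀ x → f x ≈ g x) →
               ∀ xs → ⨁ R (map f xs) ≈ ⨁ R (map g xs)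
  ⨁-map-cong f≈g []       = ≈-refl
  ⨁-map-cong f≈g (x ∷ xs) = +-cong (f≈g x) (⨁-map-cong f≈g xs)

  ⨁-map-*ˡ : ∀ {a} {A : Set a} x (f : A → Carrier) ys →
             ⨁ R (map (λ y → x * f y) ys) ≈ x * ⨁ R (map f ys)
  ⨁-map-*ˡ x f []       = sym (zeroʳ x)
  ⨁-map-*ˡ x f (y ∷ ys) = trans (+-congˡ (⨁-map-*ˡ x f ys)) (sym (distribˡ _ _ _))

  ⨁-weight : ∀ {n} (w : Weighting n) f →
    ⨁ R (map (λ I → indicator (f I) * weight w I) (interpretations n)) ≈ count w f
  ⨁-weight {zero}  w f = trans (+-identityʳ _) (*-identityʳ _)
  ⨁-weight {suc n} w f = begin
    ⨁ R (map term (map (true ∷_) Is ++ map (false ∷_) Is ++ []))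
      ≡⟨ cong (λ Js → ⨁ R (map term (map (true ∷_) Is ++ Js))) (++-identityʳ _) ⟩
    ⨁ R (map term (map (true ∷_) Is ++ map (false ∷_) Is))
      ≡⟨ cong (⨁ R) (map-++ term (map (true ∷_) Is) (map (false ∷_) Is)) ⟩
    ⨁ R (map term (map (true ∷_) Is) ++ map term (map (false ∷_) Is))
      ≈⟨ ⨁-++ (map term (map (true ∷_) Is)) _ ⟩
    ⨁ R (map term (map (true ∷_) Is)) + ⨁ R (map term (map (false ∷_) Is))
      ≈⟨ +-cong (branch true) (branch false) ⟩
    count w f
      ∎
    where
    Is = interpretations n
    term : Interpretation (suc n) → Carrier
    term I = indicator (f I) * weight w I
    term′ : Bool → Interpretation n → Carrier
    term′ b I = indicator (f (b ∷ I)) * weight (w ∘ suc) I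
    branch : ∀ b → ⨁ R (map term (map (b ∷_) Is))
                   ≈ w zero b * count (w ∘ suc) (f ∘ (b ∷_))
    branch b = begin
      ⨁ R (map term (map (b ∷_) Is))            ≡⟨ cong (⨁ R) (map-∘ Is) ⟨
      ⨁ R (map (λ I → term (b ∷ I)) Is)         ≈⟨ ⨁-map-cong (λ I → x∙yz≈y∙xz _ _ _) Is ⟩
      ⨁ R (map (λ I → w zero b * term′ b I) Is) ≈⟨ ⨁-map-*ˡ _ (term′ b) Is ⟩
      w zero b * ⨁ R (map (term′ b) Is)         ≈⟨ *-congˡ (⨁-weight (w ∘ suc) _) ⟩
      w zero b * count (w ∘ suc) (f ∘ (b ∷_))   ∎

  ⨁-models : ∀ {n} (T : Theory n) (g : Interpretation n → Carrier) Is →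
    ⨁ R (map g (filter (_⊨ᵀ? T) Is))
    ≈ ⨁ R (map (λ I → indicator (⟦ ⋀ᶠ T ⟧ I) * g I) Is)
  ⨁-models T g []       = ≈-refl
  ⨁-models T g (I ∷ Is) with ⟦ ⋀ᶠ T ⟧ I in eq
  ... | true  = begin
    ⨁ R (map g (filter (_⊨ᵀ? T) (I ∷ Is)))
      ≡⟨ cong (⨁ R ∘ map g)
              (filter-accept (_⊨ᵀ? T) (Equivalence.from (⊨ᵀ⇔⊨⋀ I T) eq)) ⟩
    g I + ⨁ R (map g (filter (_⊨ᵀ? T) Is))
      ≈⟨ +-cong (sym (*-identityˡ _)) (⨁-models T g Is) ⟩
    1# * g I + ⨁ R (map (λ J → indicator (⟦ ⋀ᶠ T ⟧ J) * g J) Is)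
      ∎
  ... | false = begin
    ⨁ R (map g (filter (_⊨ᵀ? T) (I ∷ Is)))
      ≡⟨ cong (⨁ R ∘ map g) (filter-reject (_⊨ᵀ? T) I⊭T) ⟩
    ⨁ R (map g (filter (_⊨ᵀ? T) Is))
      ≈⟨ ⨁-models T g Is ⟩
    ⨁ R (map (λ J → indicator (⟦ ⋀ᶠ T ⟧ J) * g J) Is)
      ≈⟨ +-identityˡ _ ⟨
    0# + ⨁ R (map (λ J → indicator (⟦ ⋀ᶠ T ⟧ J) * g J) Is)
      ≈⟨ +-congʳ (zeroˡ _) ⟨
    0# * g I + ⨁ R (map (λ J → indicator (⟦ ⋀ᶠ T ⟧ J) * g J) Is)
      ∎
    where
    I⊭T : ¬ I ⊨ᵀ T
    I⊭T I⊨T with () ← ≡.trans (≡.sym eq) (Equivalence.to (⊨ᵀ⇔⊨⋀ I T) I⊨T)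

  AMC≈count : ∀ {n} (α : Literal n → Carrier) T →
              AMC R α T ≈ count (labelWeighting α) ⟦ ⋀ᶠ T ⟧
  AMC≈count {n} α T = begin
    ⨁ R (map (⨂ R ∘ map α ∘ literals) (models T))
      ≈⟨ ⨁-map-cong (λ I → reflexive (cong (⨂ R) (map-tabulate (choice I) α))) (models T) ⟩
    ⨁ R (map (weight w) (models T))
      ≈⟨ ⨁-models T (weight w) (interpretations n) ⟩
    ⨁ R (map (λ I → indicator (⟦ ⋀ᶠ T ⟧ I) * weight w I) (interpretations n))
      ≈⟨ ⨁-weight w ⟦ ⋀ᶠ T ⟧ ⟩
    count w ⟦ ⋀ᶠ T ⟧
      ∎
    where
    w = labelWeighting α
    choice : Interpretation n → Fin n → Literal n
    choice I v = if lookup I v then pos v else neg v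

-- Folding over a circuit

module FoldProperties {a} {A : Set a} {n : ℕ}
                      (onLeaf : Leaf n → A) (onConj onDisj : List A → A)
                      (N : Circuit n) where
  open Circuit N
  open Fold onLeaf onConj onDisj N

  step-cong : ∀ {m} (x : Node n m) {rec rec′ : ∀ {j} → j ∈ children x → A} →
              (∀ {j} (j∈ : j ∈ children x) → rec j∈ ≡ rec′ j∈) →
              step x rec ≡ step x rec′
  step-cong (leaf l)  eq = refl
  step-cong (conj ks) eq = cong onConj (mapWith∈-cong (toList ks) _ _ eq)
  step-cong (disj ks) eq = cong onDisj (mapWith∈-cong (toList ks) _ _ eq)

  foldAcc-irrelevant : ∀ k (p q : Acc _childOf_ k) → foldAcc k p ≡ foldAcc k q
  foldAcc-irrelevant k (acc rs) (acc rs′) =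
    step-cong (node k) λ {j} j∈ → foldAcc-irrelevant j (rs j∈) (rs′ j∈)

  fold-unfold : ∀ k → fold k ≡ step (node k) (λ {j} _ → fold j)
  fold-unfold k with childOf-wellFounded k
  ... | acc rs = step-cong (node k) λ {j} j∈ → foldAcc-irrelevant j (rs j∈) (childOf-wellFounded j)

  -- The recursion equations of the fold, free of accessibility proofs.
  fold-leaf : ∀ {k l} → node k ≡ leaf l → fold k ≡ onLeaf l
  fold-leaf {k} eq with node k | fold-unfold k
  fold-leaf refl | _ | unfold = unfold

  fold-conj : ∀ {k ks} → node k ≡ conj ks → fold k ≡ onConj (map fold (toList ks))
  fold-conj {k} eq with node k | fold-unfold k
  fold-conj {ks = ks} refl | _ | unfold =
    ≡.trans unfold (cong onConj (mapWith∈≗map fold (toList ks)))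

  fold-disj : ∀ {k ks} → node k ≡ disj ks → fold k ≡ onDisj (map fold (toList ks))
  fold-disj {k} eq with node k | fold-unfold k
  fold-disj {ks = ks} refl | _ | unfold =
    ≡.trans unfold (cong onDisj (mapWith∈≗map fold (toList ks)))

-- Induction along a circuit and occurrence of variables

module _ {n : ℕ} (N : Circuit n) where
  open Circuit N

  node-induction : ∀ {p} (P : Fin size → Set p) →
    (∀ {k l} → node k ≡ leaf l → P k) →
    (∀ {k ks} → node k ≡ conj ks → All P (toList ks) → P k) →
    (∀ {k ks} → node k ≡ disj ks → All P (toList ks) → P k) →
    ∀ k → P k
  node-induction {p} P onLeaf onConj onDisj =
    WF.All.wfRec childOf-wellFounded p P λ k rec → go k (node k) refl λ {j} → rec {j}
    where
    go : ∀ k x → node k ≡ x → (∀ {j} → j childOf k → P j) → P k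
    go k (leaf l)  eq rec = onLeaf eq
    go k (conj ks) eq rec =
      onConj eq (All.tabulate λ {j} j∈ → rec (subst (j ∈_) (≡.sym (cong children eq)) j∈))
    go k (disj ks) eq rec =
      onDisj eq (All.tabulate λ {j} j∈ → rec (subst (j ∈_) (≡.sym (cong children eq)) j∈))

  occurs-child : ∀ {v j k} → j childOf k → Occurs N v j → Occurs N v k
  occurs-child j∈ (i , l , path , leaf≡ , var≡) =
    i , l , path ◅◅ (j∈ ◅ ε) , leaf≡ , var≡

  -- A disjunction rather than an implication from non-occurrence: constructively
  -- this is what turns disjointness of variables into independence.
  occurs⊎irrelevant : ∀ v k → Occurs N v k ⊎ Irrelevant v ⟦ formula N k ⟧
  occurs⊎irrelevant v = node-induction _ atLeaf atConj atDisj
    where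
    open FoldProperties leafᶠ ⋀ᶠ ⋁ᶠ N

    Result : Fin size → Set
    Result k = Occurs N v k ⊎ Irrelevant v ⟦ formula N k ⟧

    to-formula : ∀ {k φ} → formula N k ≡ φ → Irrelevant v ⟦ φ ⟧ →
                 Irrelevant v ⟦ formula N k ⟧
    to-formula eq = subst (λ φ → Irrelevant v ⟦ φ ⟧) (≡.sym eq)

    atLeaf : ∀ {k l} → node k ≡ leaf l → Result k
    atLeaf {l = top} eq = inj₂ (to-formula (fold-leaf eq) λ b I → refl)
    atLeaf {l = bot} eq = inj₂ (to-formula (fold-leaf eq) λ b I → refl)
    atLeaf {l = lit l} eq with var l ≟ v
    ... | yes u≡v = inj₁ (_ , l , ε , eq , u≡v)
    ... | no  u≢v = inj₂ (to-formula (fold-leaf eq) (irrelevant-literal l u≢v))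

    fromChildren : ∀ k {ks} → children (node k) ≡ ks → All Result ks →
      Occurs N v k ⊎ All (Irrelevant v ∘ ⟦_⟧) (map (formula N) ks)
    fromChildren k eq rs with any⊎all rs
    ... | inj₂ irrs = inj₂ (All.map⁺ irrs)
    ... | inj₁ some with j , j∈ , occ ← find some =
      inj₁ (occurs-child (subst (j ∈_) (≡.sym eq) j∈) occ)

    atConj : ∀ {k ks} → node k ≡ conj ks → All Result (toList ks) → Result k
    atConj {k} eq rs =
      map₂ (λ irrs → to-formula (fold-conj eq) (irrelevant-⋀ irrs))
           (fromChildren k (cong children eq) rs)

    atDisj : ∀ {k ks} → node k ≡ disj ks → All Result (toList ks) → Result k
    atDisj {k} eq rs =
      map₂ (λ irrs → to-formula (fold-disj eq) (irrelevant-⋁ irrs))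
           (fromChildren k (cong children eq) rs)

  disjoint⇒independent : ∀ {i j} → (∀ v → ¬ (Occurs N v i × Occurs N v j)) →
                         Independent ⟦ formula N i ⟧ ⟦ formula N j ⟧
  disjoint⇒independent {i} {j} disjoint v
    with occurs⊎irrelevant v i | occurs⊎irrelevant v j
  ... | inj₂ irr | _         = inj₁ irr
  ... | inj₁ _   | inj₂ irr  = inj₂ irr
  ... | inj₁ occ | inj₁ occ′ = contradiction (occ , occ′) (disjoint v)

-- Evaluation computes counts

module _ {c ℓ} (R : CommutativeSemiring c ℓ) {n : ℕ}
         (α : Literal n → CommutativeSemiring.Carrier R) (neutral : Neutral R α)
         (N : Circuit n) (decomposable : Decomposable N)
         (deterministic : Deterministic N) where
  open CommutativeSemiring R hiding (refl; zero)
  open CommutativeSemiring R using () renaming (refl to ≈-refl)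
  open SetoidReasoning setoid
  open Counting R
  open Circuit N

  -- The value of a node; Eval is the one at the root.
  value : Fin size → Carrier
  value = Fold.fold (evalLeaf R α) (⨂ R) (⨁ R) N

  -- The weighted count of the formula of a node.
  nodeCount : Fin size → Carrier
  nodeCount k = count (labelWeighting α) ⟦ formula N k ⟧

  value≈count : ∀ k → value k ≈ nodeCount k
  value≈count = node-induction N _ atLeaf atConj atDisj
    where
    module V = FoldProperties (evalLeaf R α) (⨂ R) (⨁ R) N
    module F = FoldProperties leafᶠ ⋀ᶠ ⋁ᶠ N

    w = labelWeighting α

    ValueIsCount : Fin size → Set ℓ
    ValueIsCount k = value k ≈ nodeCount k

    -- Stated for any congruent operation, to serve both sums and products.
    onChildren : ∀ {_∙_ e} → (∀ {x y u v} → x ≈ y → u ≈ v → (x ∙ u) ≈ (y ∙ v)) →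
      ∀ {ks} → All ValueIsCount ks →
      foldr _∙_ e (map value ks)
        ≈ foldr _∙_ e (map (count w ∘ ⟦_⟧) (map (formula N) ks))
    onChildren ∙-cong []       = ≈-refl
    onChildren ∙-cong (p ∷ ps) = ∙-cong p (onChildren ∙-cong ps)

    atLeaf : ∀ {k l} → node k ≡ leaf l → ValueIsCount k
    atLeaf {k} {l} eq = begin
      value k             ≡⟨ V.fold-leaf eq ⟩
      evalLeaf R α l      ≈⟨ evalLeaf≈count α neutral l ⟩
      count w ⟦ leafᶠ l ⟧ ≡⟨ cong (λ φ → count w ⟦ φ ⟧) (F.fold-leaf eq) ⟨
      nodeCount k         ∎

    atConj : ∀ {k ks} → node k ≡ conj ks → All ValueIsCount (toList ks) →
             ValueIsCount k
    atConj {k} {ks} eq ps = begin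
      value k
        ≡⟨ V.fold-conj eq ⟩
      ⨂ R (map value (toList ks))
        ≈⟨ onChildren *-cong ps ⟩
      ⨂ R (map (count w ∘ ⟦_⟧) (map (formula N) (toList ks)))
        ≈⟨ count-⋀ w neutral (AllPairs.map⁺
             (AllPairs.map (disjoint⇒independent N) (decomposable k ks eq))) ⟨
      count w ⟦ ⋀ᶠ (map (formula N) (toList ks)) ⟧
        ≡⟨ cong (λ φ → count w ⟦ φ ⟧) (F.fold-conj eq) ⟨
      nodeCount k
        ∎

    atDisj : ∀ {k ks} → node k ≡ disj ks → All ValueIsCount (toList ks) →
             ValueIsCount k
    atDisj {k} {ks} eq ps = begin
      value k
        ≡⟨ V.fold-disj eq ⟩
      ⨁ R (map value (toList ks))
        ≈⟨ onChildren +-cong ps ⟩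
      ⨁ R (map (count w ∘ ⟦_⟧) (map (formula N) (toList ks)))
        ≈⟨ count-⋁ w (AllPairs.map⁺ (deterministic k ks eq)) ⟨
      count w ⟦ ⋁ᶠ (map (formula N) (toList ks)) ⟧
        ≡⟨ cong (λ φ → count w ⟦ φ ⟧) (F.fold-disj eq) ⟨
      nodeCount k
        ∎

theorem4 : ∀ {c ℓ : Level} (R : CommutativeSemiring c ℓ) {n : ℕ}
    (T : Theory n) (α : Literal n → CommutativeSemiring.Carrier R) →
    Neutral R α →
    (N : Circuit n) → IsDDNNF N T →
    CommutativeSemiring._≈_ R (Eval R α N) (AMC R α T)
theorem4 R T α neutral N ddnnf = begin
  Eval R α N
    ≈⟨ value≈count R α neutral N decomposable deterministic root ⟩
  count w ⟦ formula N root ⟧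
    ≈⟨ count-cong w (λ I → ⇔→≡ (⊨ᵀ⇔⊨⋀ I T ⇔-∘ equivalent I)) ⟩
  count w ⟦ ⋀ᶠ T ⟧
    ≈⟨ AMC≈count α T ⟨
  AMC R α T
    ∎
  where
  open SetoidReasoning (CommutativeSemiring.setoid R)
  open Counting R
  open Circuit N using (root)
  open IsDDNNF ddnnf
  w = labelWeighting α
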